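{- Let $k\geq 1$ be an integer. Every finite simple graph with at least one vertex and with minimum degree at least $3k-1$ has a $(k+1)$-connected subgraph on more than $2k$ vertices.
   Context: A graph is $(k+1)$-connected if it has more than $k+1$ vertices and remains connected after deleting any set of at most $k$ vertices. -}

module Defs where

open import Data.Nat using (ℕ; suc; _≤_; _<_; _*_; _∸_)
open import Data.Bool using (Bool; true; false; T)
open import Data.Fin using (Fin)
open import Data.Fin.Subset using (Subset; _∈_; _∉_; ∣_∣)
open import Data.List using (length; filterᵇ; allFin)
open import Data.Product using (Σ; _×_)
open import Function.Definitions using (Injective)
open import Relation.Binary.PropositionalEquality using (_≡_)
open import Relation.Nullary using (¬_)

record Graph (n : ℕ) : Set where
  field
    adj   : Fin n → Fin n → Bool
    sym   : ∀ u v → adj u v ≡ adj v u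
    irrefl : ∀ v → adj v v ≡ false
open Graph public

degree : ∀ {n} → Graph n → Fin n → ℕ
degree G v = length (filterᵇ (adj G v) (allFin _))

MinDegree≥ : ∀ {n} → Graph n → ℕ → Set
MinDegree≥ G d = ∀ v → d ≤ degree G v

IsSubgraph : ∀ {m n} → Graph m → Graph n → Set
IsSubgraph {m} {n} H G =
  Σ (Fin m → Fin n) λ f →
    Injective _≡_ _≡_ f × (∀ u v → T (adj H u v) → T (adj G (f u) (f v)))

data ReachAvoiding {n} (G : Graph n) (X : Subset n) : Fin n → Fin n → Set where
  here : ∀ {u} → u ∉ X → ReachAvoiding G X u u
  step : ∀ {u w v} → u ∉ X → T (adj G u w) →
         ReachAvoiding G X w v → ReachAvoiding G X u v

ConnectedAfterDeleting : ∀ {n} → Graph n → Subset n → Set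
ConnectedAfterDeleting G X = ∀ u v → u ∉ X → v ∉ X → ReachAvoiding G X u v

_-Connected : ∀ {n} → ℕ → Graph n → Set
_-Connected {n} c G = Σ (c < n) λ _ →
  ∀ (X : Subset n) → suc ∣ X ∣ ≤ c → ConnectedAfterDeleting G X

{-# OPTIONS --safe #-}
module Submission where

-- For a vertex set S give v ∈ S the weight min(k, (3k − 1 − deg_S v)⁺).  If G has no subgraph as
-- desired, every S with |S| ≥ 2k has total weight at least 2k²; for S = V this contradicts the
-- minimum degree condition, under which all weights vanish.
-- The bound is clear if |S| = 2k.  Otherwise S is a disjoint union a ∪ x ∪ b with |x| ≤ k, a and b
-- nonempty and no edge between a and b.  If both sides a ∪ x and b ∪ x have at least 2k vertices,
-- each has weight ≥ 2k² by induction, of which at most k² lies on x, so a and b retain ≥ k² each.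
-- If only b ∪ x does, then adding a brings |a| vertices of weight k and decreases the weight of
-- each of the ≤ k vertices of x by at most |a|.  If both sides are small, all vertices of a and b
-- have weight k and those of x have weight at least min(k, (3k − |S|)⁺), which is again enough.

open import Defs
open import Data.Nat using (ℕ; zero; suc; _≤_; _<_; _*_; _∸_; _+_; _⊓_; z≤n; s≤s; s≤s⁻¹; _≤?_)
open import Data.Nat.Properties hiding (suc-injective)
open import Data.Nat.Tactic.RingSolver using (solve-∀)
open import Algebra.Properties.Semiring.Sum +-*-semiring using (sum; ∑-distrib-+; sum-cong-≗; *-distribʳ-sum)
open import Data.Bool using (Bool; true; false; T; T?)
open import Data.Fin using (Fin; zero; suc; fromℕ<)
open import Data.Fin.Properties using (any?; suc-injective)
open import Data.Fin.Subset using (Subset; _∈_; _∉_; ∣_∣; ⊤; ⁅_⁆; ∁; _∩_; _∪_; _⊃_)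
open import Data.Fin.Subset.Induction using (Acc; acc; ⊃-wellFounded)
open import Data.Fin.Subset.Properties using (_∈?_; anySubset?; ∣⊤∣≡n; x∈⁅x⁆; x∈⁅y⁆⇒x≡y; p⊆p∪q; q⊆p∪q; x∈p∪q⁻; x∈p∩q⁻; x∈p∩q⁺; x∈∁p⇒x∉p; x∉p⇒x∈∁p; x∈p⇒∣p-x∣<∣p∣)
open import Data.List using (length; filterᵇ; tabulate)
open import Data.Product using (Σ; _×_; _,_; ∃)
open import Data.Sum using (_⊎_; inj₁; inj₂)
open import Data.Vec using ([]; _∷_; here; there; lookup)
open import Data.Vec.Properties using (lookup-replicate; lookup⇒[]=)
open import Function using (_∘_; id)
open import Function.Definitions using (Injective)
open import Relation.Binary.PropositionalEquality using (_≡_; _≗_; refl; trans; cong; cong₂; subst; subst₂; module ≡-Reasoning) renaming (sym to ≡-sym)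
open import Relation.Nullary using (¬_; ¬?; Dec; yes; no; contradiction; _×-dec_)

private variable n : ℕ

-- Arithmetic and sums over vertices.

+-reverse : ∀ p q r → p + q + r ≡ r + q + p
+-reverse = solve-∀

+-swapʳ : ∀ p q r → p + q + r ≡ p + r + q
+-swapʳ = solve-∀

2kk : ∀ k → 2 * k * k ≡ k * k + k * k
2kk = solve-∀

infixl 6 _⊕_
-- Vertex sets enter the counting as ℕ-valued functions, so that disjoint union becomes pointwise
-- addition and weighted sums split by distributivity.
_⊕_ : (Fin n → ℕ) → (Fin n → ℕ) → Fin n → ℕ
(p ⊕ q) v = p v + q v

sum-⊕ : (p q : Fin n → ℕ) → sum (p ⊕ q) ≡ sum p + sum q
sum-⊕ = ∑-distrib-+

sum-mono : {f g : Fin n → ℕ} → (∀ v → f v ≤ g v) → sum f ≤ sum g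
sum-mono {n = zero}  f≤g = z≤n
sum-mono {n = suc n} f≤g = +-mono-≤ (f≤g zero) (sum-mono (f≤g ∘ suc))

sum-mono-< : {f g : Fin n → ℕ} → (∀ v → f v ≤ g v) → ∀ w → f w < g w → sum f < sum g
sum-mono-< f≤g zero    f<g = +-mono-<-≤ f<g (sum-mono (f≤g ∘ suc))
sum-mono-< f≤g (suc w) f<g = +-mono-≤-< (f≤g zero) (sum-mono-< (f≤g ∘ suc) w f<g)

weighted-⊕ : (p q f : Fin n → ℕ) →
  sum (λ v → (p ⊕ q) v * f v) ≡ sum (λ v → p v * f v) + sum (λ v → q v * f v)
weighted-⊕ p q f = trans (sum-cong-≗ (λ v → *-distribʳ-+ (f v) (p v) (q v)))
  (∑-distrib-+ (λ v → p v * f v) (λ v → q v * f v))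

weighted-mono : (p : Fin n → ℕ) {f g : Fin n → ℕ} → (∀ v → 1 ≤ p v → f v ≤ g v) →
  sum (λ v → p v * f v) ≤ sum (λ v → p v * g v)
weighted-mono p {f} {g} f≤g = sum-mono λ v → helper v (p v) refl
  where
  helper : ∀ v m → p v ≡ m → m * f v ≤ m * g v
  helper v zero    _  = z≤n
  helper v (suc m) eq = *-monoʳ-≤ (suc m) (f≤g v (subst (1 ≤_) (≡-sym eq) (s≤s z≤n)))

-- If k = x + y = t + m and a + b + x = 2k + t, the two sides differ by exactly t * y.
two-small-sides : ∀ a b x k → x ≤ k → 2 * k ≤ a + x + b →
  2 * k * k ≤ (a + b) * k + x * (k ⊓ (3 * k ∸ (a + x + b)))
two-small-sides a b x k x≤k 2k≤n
  with m≤n⇒∃[o]m+o≡n 2k≤n | m≤n⇒∃[o]m+o≡n x≤k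
... | t , 2k+t≡n | y , x+y≡k with k ≤? t
-- Here there are at least 3k vertices, at most k of them in `x`, so `a + b` is at least 2k and the
-- first summand suffices.
...   | yes k≤t = ≤-trans (*-monoˡ-≤ k (+-cancelʳ-≤ k (2 * k) (a + b) 3k≤)) (m≤m+n _ _)
  where
  open ≤-Reasoning
  3k≤ : 2 * k + k ≤ a + b + k
  3k≤ = begin
    2 * k + k   ≤⟨ +-monoʳ-≤ (2 * k) k≤t ⟩
    2 * k + t   ≡⟨ 2k+t≡n ⟩
    a + x + b   ≡⟨ +-swapʳ a x b ⟩
    a + b + x   ≤⟨ +-monoʳ-≤ (a + b) x≤k ⟩
    a + b + k   ∎
...   | no k≰t with m≤n⇒∃[o]m+o≡n (<⇒≤ (≰⇒> k≰t))
...     | m , t+m≡k = begin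
    2 * k * k                          ≤⟨ m≤m+n _ (t * y) ⟩
    2 * k * k + t * y                  ≡⟨ expand ⟩
    (k + t + y) * k + x * m            ≡⟨ cong₂ (λ p q → p * k + x * q) (≡-sym a+b) (≡-sym last-factor) ⟩
    (a + b) * k + x * (k ⊓ (3 * k ∸ (a + x + b))) ∎
  where
  open ≤-Reasoning
  sum-x-y-t : ∀ x y t → x + y + t + y + x ≡ 2 * (x + y) + t
  sum-x-y-t = solve-∀
  3k-split : ∀ k → 2 * k + k ≡ 3 * k
  3k-split = solve-∀
  exchange : ∀ x y t m k → k * k + (x + y) * (t + m) + t * y ≡ k * k + t * (x + y) + y * (t + m) + x * m
  exchange = solve-∀
  collect : ∀ x y t m k → k * k + t * k + y * k + x * m ≡ (k + t + y) * k + x * m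
  collect = solve-∀
  a+b : a + b ≡ k + t + y
  a+b = +-cancelʳ-≡ x (a + b) (k + t + y) (≡-sym (begin-equality
    k + t + y + x         ≡⟨ cong (λ z → z + t + y + x) (≡-sym x+y≡k) ⟩
    x + y + t + y + x     ≡⟨ sum-x-y-t x y t ⟩
    2 * (x + y) + t       ≡⟨ cong (λ z → 2 * z + t) x+y≡k ⟩
    2 * k + t             ≡⟨ 2k+t≡n ⟩
    a + x + b             ≡⟨ +-swapʳ a x b ⟩
    a + b + x             ∎))
  3k : 3 * k ≡ a + x + b + m
  3k = begin-equality
    3 * k           ≡⟨ 3k-split k ⟨
    2 * k + k       ≡⟨ cong (2 * k +_) (≡-sym t+m≡k) ⟩
    2 * k + (t + m) ≡⟨ +-assoc (2 * k) t m ⟨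
    2 * k + t + m   ≡⟨ cong (_+ m) 2k+t≡n ⟩
    a + x + b + m   ∎
  -- Now `3 * k` exceeds the size by `m`, which is at most k, so neither the minimum nor the
  -- truncated subtraction takes effect.
  last-factor : k ⊓ (3 * k ∸ (a + x + b)) ≡ m
  last-factor = begin-equality
    k ⊓ (3 * k ∸ (a + x + b))             ≡⟨ cong (λ z → k ⊓ (z ∸ (a + x + b))) 3k ⟩
    k ⊓ (a + x + b + m ∸ (a + x + b))     ≡⟨ cong (k ⊓_) (m+n∸m≡n (a + x + b) m) ⟩
    k ⊓ m                                 ≡⟨ m≥n⇒m⊓n≡n (subst (m ≤_) t+m≡k (m≤n+m m t)) ⟩
    m                                     ∎
  expand : 2 * k * k + t * y ≡ (k + t + y) * k + x * m
  expand = begin-equality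
    2 * k * k + t * y                             ≡⟨ cong (_+ t * y) (2kk k) ⟩
    k * k + k * k + t * y                         ≡⟨ cong₂ (λ p q → k * k + p * q + t * y) (≡-sym x+y≡k) (≡-sym t+m≡k) ⟩
    k * k + (x + y) * (t + m) + t * y             ≡⟨ exchange x y t m k ⟩
    k * k + t * (x + y) + y * (t + m) + x * m     ≡⟨ cong₂ (λ p q → k * k + t * p + y * q + x * m) x+y≡k t+m≡k ⟩
    k * k + t * k + y * k + x * m                 ≡⟨ collect x y t m k ⟩
    (k + t + y) * k + x * m                       ∎

-- Weights, and how they change across a separation.

module Weights (k : ℕ) (e : Fin n → Fin n → ℕ) (e≤1 : ∀ u v → e u v ≤ 1)
  (e-sym : ∀ u v → e u v ≡ e v u) (e-irrefl : ∀ v → e v v ≡ 0) where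

  deg : (Fin n → ℕ) → Fin n → ℕ
  deg w v = sum (λ u → w u * e v u)

  -- Always applied to suc (deg w v): this is where 3k − 1 − deg comes from.
  φ : ℕ → ℕ
  φ d = k ⊓ (3 * k ∸ d)

  -- `p` is the set summed over and `w` the set in which degrees are measured; `W w w` is the total
  -- weight of `w`.
  W : (Fin n → ℕ) → (Fin n → ℕ) → ℕ
  W p w = sum (λ v → p v * φ (suc (deg w v)))

  deg-⊕ : ∀ p q v → deg (p ⊕ q) v ≡ deg p v + deg q v
  deg-⊕ p q v = weighted-⊕ p q (e v)

  deg≤sum : ∀ p v → deg p v ≤ sum p
  deg≤sum p v = sum-mono λ u → ≤-trans (*-monoʳ-≤ (p u) (e≤1 v u)) (≤-reflexive (*-identityʳ (p u)))

  -- Having no loop, `v` counts towards `sum p` but not towards its own degree. The unit gained pays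
  -- for the `suc` inside `W`.
  deg<sum : ∀ p v → 1 ≤ p v → deg p v < sum p
  deg<sum p v 1≤pv = sum-mono-<
    (λ u → ≤-trans (*-monoʳ-≤ (p u) (e≤1 v u)) (≤-reflexive (*-identityʳ (p u))))
    v (subst (_< p v) (≡-sym (trans (cong (p v *_) (e-irrefl v)) (*-zeroʳ (p v)))) 1≤pv)

  φ≤k : ∀ d → φ d ≤ k
  φ≤k d = m⊓n≤m k _

  φ-anti : ∀ {c d} → c ≤ d → φ d ≤ φ c
  φ-anti c≤d = ⊓-monoʳ-≤ k (∸-monoʳ-≤ (3 * k) c≤d)

  -- Raising the degree by `c` lowers `3 * k ∸ d` by at most `c`, and capping at `k` cannot enlarge
  -- the loss.
  φ-lipschitz : ∀ d c → φ d ≤ φ (d + c) + c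
  φ-lipschitz d c = begin
    k ⊓ (3 * k ∸ d)                    ≤⟨ ⊓-mono-≤ (m≤m+n k c) (m≤n+m∸n (3 * k ∸ d) c) ⟩
    (k + c) ⊓ (c + (3 * k ∸ d ∸ c))    ≡⟨ cong ((k + c) ⊓_) (trans (+-comm c _) (cong (_+ c) (∸-+-assoc (3 * k) d c))) ⟩
    (k + c) ⊓ ((3 * k ∸ (d + c)) + c)  ≡⟨ +-distribʳ-⊓ c k (3 * k ∸ (d + c)) ⟨
    φ (d + c) + c                      ∎
    where open ≤-Reasoning

  k≤φ : ∀ {d} → d ≤ 2 * k → k ≤ φ d
  k≤φ {d} d≤2k = ⊓-glb ≤-refl (m+n≤o⇒m≤o∸n k (+-monoʳ-≤ k d≤2k))

  W-⊕ : ∀ p q w → W (p ⊕ q) w ≡ W p w + W q w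
  W-⊕ p q w = weighted-⊕ p q (φ ∘ suc ∘ deg w)

  W-cong : ∀ {w w′} → w ≗ w′ → W w w ≡ W w′ w′
  W-cong w≗w′ = sum-cong-≗ λ v → cong₂ _*_ (w≗w′ v)
    (cong (φ ∘ suc) (sum-cong-≗ λ u → cong (_* e v u) (w≗w′ u)))

  W≤ : ∀ p w {c} → (∀ v → φ (suc (deg w v)) ≤ c) → W p w ≤ sum p * c
  W≤ p w {c} ≤c = ≤-trans (weighted-mono p (λ v _ → ≤c v)) (≤-reflexive (≡-sym (*-distribʳ-sum c p)))

  ≤W : ∀ p w {c} → (∀ v → 1 ≤ p v → c ≤ φ (suc (deg w v))) → sum p * c ≤ W p w
  ≤W p w c≤ = ≤-trans (≤-reflexive (*-distribʳ-sum _ p)) (weighted-mono p c≤)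

  W-anti : ∀ p w w′ → (∀ v → 1 ≤ p v → deg w v ≤ deg w′ v) → W p w′ ≤ W p w
  W-anti p w w′ le = weighted-mono p λ v 1≤pv → φ-anti (s≤s (le v 1≤pv))

  module OneSide (a x b : Fin n → ℕ) (x≤k : sum x ≤ k)
    (apart : ∀ u v → a u * (b v * e u v) ≡ 0) where

    S C D : Fin n → ℕ
    S = a ⊕ x ⊕ b
    C = a ⊕ x
    -- With `b` first, exchanging `a` and `b` turns `C` into `D` definitionally.
    D = b ⊕ x

    -- By `apart`, a vertex of `a` has no neighbour in `b`.
    a-degree : ∀ v → 1 ≤ a v → deg S v ≤ deg C v
    a-degree v 1≤av = sum-mono λ u → ≤-reflexive (begin
      (a u + x u + b u) * e v u           ≡⟨ *-distribʳ-+ (e v u) (a u + x u) (b u) ⟩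
      (a u + x u) * e v u + b u * e v u   ≡⟨ cong ((a u + x u) * e v u +_) (be≡0 u) ⟩
      (a u + x u) * e v u + 0             ≡⟨ +-identityʳ _ ⟩
      (a u + x u) * e v u                 ∎)
      where
      open ≡-Reasoning
      be≡0 : ∀ u → b u * e v u ≡ 0
      be≡0 u with m*n≡0⇒m≡0∨n≡0 (a v) (apart v u)
      ... | inj₁ a≡0  = contradiction (subst (1 ≤_) a≡0 1≤av) λ ()
      ... | inj₂ be≡0 = be≡0

    W-S : W S S ≡ W a S + W x S + W b S
    W-S = trans (W-⊕ C b S) (cong (_+ W b S) (W-⊕ a x S))

    -- All neighbours of a vertex of `a` lie in `C`, so there are fewer than 2k of them and the
    -- vertex has full weight `k`.
    W-a-small : sum C ≤ 2 * k → sum a * k ≤ W a S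
    W-a-small C≤2k = ≤W a S λ v 1≤av → k≤φ
      (≤-trans (s≤s (a-degree v 1≤av)) (≤-trans (deg<sum C v (≤-trans 1≤av (m≤m+n _ _))) C≤2k))

    -- The part of the weight of `C` lying on `a` survives in `S`, because degrees on `a` do not
    -- grow.
    W-a-big : 2 * k * k ≤ W C C → k * k ≤ W a S
    W-a-big bound = +-cancelʳ-≤ (k * k) _ _ (begin
      k * k + k * k      ≡⟨ 2kk k ⟨
      2 * k * k          ≤⟨ bound ⟩
      W C C              ≡⟨ W-⊕ a x C ⟩
      W a C + W x C      ≤⟨ +-mono-≤ (W-anti a S C a-degree) (≤-trans (W≤ x C (φ≤k ∘ suc ∘ deg C)) (*-monoˡ-≤ k x≤k)) ⟩
      W a S + k * k      ∎)
      where open ≤-Reasoning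

    S-size : sum S ≡ sum a + sum x + sum b
    S-size = trans (sum-⊕ C b) (cong (_+ sum b) (sum-⊕ a x))

  module TwoSides (a x b : Fin n → ℕ) (x≤k : sum x ≤ k)
    (apart : ∀ u v → a u * (b v * e u v) ≡ 0) where

    apart′ : ∀ u v → b u * (a v * e u v) ≡ 0
    apart′ u v = trans (rotate (b u) (a v) (e u v))
      (trans (cong (λ z → a v * (b u * z)) (e-sym u v)) (apart v u))
      where
      rotate : ∀ p q r → p * (q * r) ≡ q * (p * r)
      rotate = solve-∀

    module L = OneSide a x b x≤k apart
    module R = OneSide b x a x≤k apart′
    open L using (S; C; D; W-S)

    -- The two instances of `OneSide` add the parts in opposite orders, so their whole sets agree
    -- only pointwise.
    swap : R.S ≗ S
    swap v = +-reverse (b v) (x v) (a v)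

    deg-swap : ∀ v → deg R.S v ≡ deg S v
    deg-swap v = sum-cong-≗ λ u → cong (_* e v u) (swap u)

    W-b-swap : W b R.S ≤ W b S
    W-b-swap = W-anti b S R.S λ v _ → ≤-reflexive (≡-sym (deg-swap v))

    both-big : 2 * k * k ≤ W C C → 2 * k * k ≤ W D D → 2 * k * k ≤ W S S
    both-big C-bound D-bound = begin
      2 * k * k               ≡⟨ 2kk k ⟩
      k * k + k * k           ≤⟨ +-mono-≤ (L.W-a-big C-bound) (≤-trans (R.W-a-big D-bound) W-b-swap) ⟩
      W a S + W b S           ≤⟨ +-monoˡ-≤ (W b S) (m≤m+n (W a S) (W x S)) ⟩
      W a S + W x S + W b S   ≡⟨ W-S ⟨
      W S S                   ∎
      where open ≤-Reasoning

    both-small : sum C ≤ 2 * k → sum D ≤ 2 * k → 2 * k ≤ sum S → 2 * k * k ≤ W S S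
    both-small C≤2k D≤2k 2k≤S = begin
      2 * k * k                                          ≤⟨ two-small-sides (sum a) (sum b) (sum x) k x≤k (subst (2 * k ≤_) L.S-size 2k≤S) ⟩
      (sum a + sum b) * k + sum x * φ (sum a + sum x + sum b)  ≡⟨ cong₂ (λ p q → p + sum x * φ q) (*-distribʳ-+ k (sum a) (sum b)) (≡-sym L.S-size) ⟩
      sum a * k + sum b * k + sum x * φ (sum S)          ≤⟨ +-mono-≤ (+-mono-≤ (L.W-a-small C≤2k) (≤-trans (R.W-a-small D≤2k) W-b-swap))
                                                              -- A vertex of `x` may be adjacent to
                                                              -- all others, so only the trivial
                                                              -- bound on its degree, below the size
                                                              -- of `S`, is used.
                                                              (≤W x S λ v 1≤xv → φ-anti (deg<sum S v (≤-trans 1≤xv (≤-trans (m≤n+m _ (a v)) (m≤m+n _ _))))) ⟩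
      W a S + W b S + W x S                              ≡⟨ +-swapʳ (W a S) (W b S) (W x S) ⟩
      W a S + W x S + W b S                              ≡⟨ W-S ⟨
      W S S                                              ∎
      where open ≤-Reasoning

    -- Passing from `D` to `S`, the vertices of `b` lose no weight, and the loss on `x`, at most
    -- `k * sum a`, is made up by the full weights on `a`.
    C-small : sum C ≤ 2 * k → 2 * k * k ≤ W D D → 2 * k * k ≤ W S S
    C-small C≤2k D-bound = begin
      2 * k * k                            ≤⟨ D-bound ⟩
      W D D                                ≡⟨ W-⊕ b x D ⟩
      W b D + W x D                        ≤⟨ +-mono-≤ (≤-trans (W-anti b R.S D R.a-degree) W-b-swap) x-loss ⟩
      W b S + (W x S + sum x * sum a)      ≤⟨ +-monoʳ-≤ (W b S) (+-monoʳ-≤ (W x S) (*-monoˡ-≤ (sum a) x≤k)) ⟩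
      W b S + (W x S + k * sum a)          ≡⟨ cong (λ z → W b S + (W x S + z)) (*-comm k (sum a)) ⟩
      W b S + (W x S + sum a * k)          ≤⟨ +-monoʳ-≤ (W b S) (+-monoʳ-≤ (W x S) (L.W-a-small C≤2k)) ⟩
      W b S + (W x S + W a S)              ≡⟨ trans (≡-sym (+-assoc (W b S) (W x S) (W a S))) (+-reverse (W b S) (W x S) (W a S)) ⟩
      W a S + W x S + W b S                ≡⟨ W-S ⟨
      W S S                                ∎
      where
      open ≤-Reasoning
      loss : ∀ v → φ (suc (deg D v)) ≤ φ (suc (deg S v)) + sum a
      loss v = begin
        φ (suc (deg D v))                       ≤⟨ φ-lipschitz (suc (deg D v)) (deg a v) ⟩
        -- `D ⊕ a` is `R.S` by definition.
        φ (suc (deg D v + deg a v)) + deg a v   ≡⟨ cong (λ z → φ (suc z) + deg a v) (trans (≡-sym (deg-⊕ D a v)) (deg-swap v)) ⟩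
        φ (suc (deg S v)) + deg a v             ≤⟨ +-monoʳ-≤ _ (deg≤sum a v) ⟩
        φ (suc (deg S v)) + sum a               ∎
      x-loss : W x D ≤ W x S + sum x * sum a
      x-loss = begin
        W x D                                                  ≤⟨ weighted-mono x (λ v _ → loss v) ⟩
        sum (λ v → x v * (φ (suc (deg S v)) + sum a))          ≡⟨ sum-cong-≗ (λ v → *-distribˡ-+ (x v) _ (sum a)) ⟩
        sum (λ v → x v * φ (suc (deg S v)) + x v * sum a)      ≡⟨ ∑-distrib-+ (λ v → x v * φ (suc (deg S v))) (λ v → x v * sum a) ⟩
        W x S + sum (λ v → x v * sum a)                        ≡⟨ cong (W x S +_) (*-distribʳ-sum (sum a) x) ⟨
        W x S + sum x * sum a                                  ∎

-- Connectivity versus cuts.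

-- `A` may meet `X`: the two sides of the cut are the parts of `A` and of its complement outside
-- `X`. Arbitrary pairs of subsets can then be searched.
Crossing Cut : Graph n → Subset n → Subset n → Set
Crossing G X A = ∃ λ i → ∃ λ j → (i ∈ A × i ∉ X) × (j ∉ A × j ∉ X) × T (adj G i j)
Cut G X A = (∃ λ i → i ∈ A × i ∉ X) × (∃ λ j → j ∉ A × j ∉ X) × ¬ Crossing G X A

crossing? : (G : Graph n) (X A : Subset n) → Dec (Crossing G X A)
crossing? G X A = any? λ i → any? λ j →
  ((i ∈? A) ×-dec ¬? (i ∈? X)) ×-dec (¬? (j ∈? A) ×-dec ¬? (j ∈? X)) ×-dec T? (adj G i j)

cut? : (G : Graph n) (X A : Subset n) → Dec (Cut G X A)
cut? G X A =
  any? (λ i → (i ∈? A) ×-dec ¬? (i ∈? X)) ×-dec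
  any? (λ j → ¬? (j ∈? A) ×-dec ¬? (j ∈? X)) ×-dec
  ¬? (crossing? G X A)

-- Grow a set of vertices known to reach v; while it misses u, some edge leaves it.
uncut⇒connected : (G : Graph n) (X : Subset n) → (∀ A → ¬ Cut G X A) → ConnectedAfterDeleting G X
uncut⇒connected {n} G X uncut u v u∉X v∉X =
  grow ⁅ v ⁆ (⊃-wellFounded ⁅ v ⁆) (x∈⁅x⁆ v)
    λ i∈⁅v⁆ → subst (λ i → ReachAvoiding G X i v) (≡-sym (x∈⁅y⁆⇒x≡y v i∈⁅v⁆)) (here v∉X)
  where
  grow : ∀ A → Acc _⊃_ A → v ∈ A → (∀ {i} → i ∈ A → ReachAvoiding G X i v) → ReachAvoiding G X u v
  grow A (acc rec) v∈A reach with u ∈? A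
  ... | yes u∈A = reach u∈A
  ... | no  u∉A with crossing? G X A
  -- With no edge leaving it, `A` would be a cut that has `v` on one side and `u` on the other.
  ...   | no ¬crossing = contradiction ((v , v∈A , v∉X) , (u , u∉A , u∉X) , ¬crossing) (uncut A)
  ...   | yes (i , j , (i∈A , _) , (j∉A , j∉X) , ij) =
    grow (A ∪ ⁅ j ⁆) (rec (p⊆p∪q ⁅ j ⁆ , j , q⊆p∪q A ⁅ j ⁆ (x∈⁅x⁆ j) , j∉A)) (p⊆p∪q ⁅ j ⁆ v∈A) reach′
    where
    reach′ : ∀ {h} → h ∈ A ∪ ⁅ j ⁆ → ReachAvoiding G X h v
    reach′ h∈ with x∈p∪q⁻ A ⁅ j ⁆ h∈
    ... | inj₁ h∈A = reach h∈A
    ... | inj₂ h∈⁅j⁆ rewrite x∈⁅y⁆⇒x≡y j h∈⁅j⁆ = step j∉X (subst T (Graph.sym G i j) ij) (reach i∈A)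

-- There are finitely many pairs of subsets and `Cut` is decidable, so exhaustive search stands in
-- for excluded middle.
connected-or-cut : (G : Graph n) (k : ℕ) →
  (∀ X → ∣ X ∣ ≤ k → ConnectedAfterDeleting G X) ⊎ (∃ λ X → ∃ λ A → ∣ X ∣ ≤ k × Cut G X A)
connected-or-cut G k
  with anySubset? (λ X → anySubset? λ A → (∣ X ∣ ≤? k) ×-dec cut? G X A)
... | yes cut = inj₂ cut
... | no ¬cut = inj₁ λ X ∣X∣≤k → uncut⇒connected G X λ A cut → ¬cut (X , A , ∣X∣≤k , cut)

-- Indicator functions and induced subgraphs.

χᵇ : Bool → ℕ
χᵇ false = 0
χᵇ true  = 1

χᵇ≤1 : ∀ b → χᵇ b ≤ 1
χᵇ≤1 false = z≤n
χᵇ≤1 true  = ≤-refl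

χ : Subset n → Fin n → ℕ
χ S v = χᵇ (lookup S v)

sum-χ : (S : Subset n) → sum (χ S) ≡ ∣ S ∣
sum-χ []          = refl
sum-χ (false ∷ S) = sum-χ S
sum-χ (true  ∷ S) = cong suc (sum-χ S)

-- The inequality expresses disjointness at `v`.
χ-∪ : (p q : Subset n) (v : Fin n) → χ p v + χ q v ≤ 1 → χ (p ∪ q) v ≡ χ p v + χ q v
χ-∪ (true  ∷ p) (true  ∷ q) zero (s≤s ())
χ-∪ (true  ∷ p) (false ∷ q) zero _ = refl
χ-∪ (false ∷ p) (b     ∷ q) zero _ = refl
χ-∪ (_     ∷ p) (_     ∷ q) (suc v) le = χ-∪ p q v le

χ-partition : (A X : Subset n) (v : Fin n) → χ (A ∩ ∁ X) v + χ X v + χ (∁ A ∩ ∁ X) v ≡ 1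
χ-partition (true  ∷ A) (true  ∷ X) zero = refl
χ-partition (true  ∷ A) (false ∷ X) zero = refl
χ-partition (false ∷ A) (true  ∷ X) zero = refl
χ-partition (false ∷ A) (false ∷ X) zero = refl
χ-partition (_ ∷ A) (_ ∷ X) (suc v) = χ-partition A X v

-- The increasing enumeration of the members of `S`, which numbers the vertices of the induced
-- subgraph.
embed : (S : Subset n) → Fin ∣ S ∣ → Fin n
embed (false ∷ S) i       = suc (embed S i)
embed (true  ∷ S) zero    = zero
embed (true  ∷ S) (suc i) = suc (embed S i)

embed-injective : (S : Subset n) → Injective _≡_ _≡_ (embed S)
embed-injective (false ∷ S) eq = embed-injective S (suc-injective eq)
embed-injective (true  ∷ S) {zero}  {zero}  _  = refl
embed-injective (true  ∷ S) {suc i} {suc j} eq = cong suc (embed-injective S (suc-injective eq))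

image : (S : Subset n) → Subset ∣ S ∣ → Subset n
image []          _       = []
image (false ∷ S) Y       = false ∷ image S Y
image (true  ∷ S) (y ∷ Y) = y ∷ image S Y

∣image∣ : (S : Subset n) (Y : Subset ∣ S ∣) → ∣ image S Y ∣ ≡ ∣ Y ∣
∣image∣ []          []          = refl
∣image∣ (false ∷ S) Y           = ∣image∣ S Y
∣image∣ (true  ∷ S) (false ∷ Y) = ∣image∣ S Y
∣image∣ (true  ∷ S) (true  ∷ Y) = cong suc (∣image∣ S Y)

image⁻ : (S : Subset n) (Y : Subset ∣ S ∣) {v : Fin n} → v ∈ image S Y → ∃ λ i → embed S i ≡ v × i ∈ Y
image⁻ (false ∷ S) Y (there v∈) with i , eq , i∈Y ← image⁻ S Y v∈ = i , cong suc eq , i∈Y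
image⁻ (true ∷ S) (_ ∷ Y) here = zero , refl , here
image⁻ (true ∷ S) (_ ∷ Y) (there v∈) with i , eq , i∈Y ← image⁻ S Y v∈ = suc i , cong suc eq , there i∈Y

-- Off `S` all three images vanish; on `S` they copy the partition of the index set.
image-partition : (S : Subset n) (p q r : Subset ∣ S ∣) → (∀ i → χ p i + χ q i + χ r i ≡ 1) →
  ∀ v → χ S v ≡ χ (image S p) v + χ (image S q) v + χ (image S r) v
image-partition (false ∷ S) p q r eq zero    = refl
image-partition (false ∷ S) p q r eq (suc v) = image-partition S p q r eq v
image-partition (true ∷ S) (_ ∷ p) (_ ∷ q) (_ ∷ r) eq zero    = ≡-sym (eq zero)
image-partition (true ∷ S) (_ ∷ p) (_ ∷ q) (_ ∷ r) eq (suc v) = image-partition S p q r (eq ∘ suc) v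

induced : (G : Graph n) (S : Subset n) → Graph ∣ S ∣
induced G S = record
  { adj    = λ i j → adj G (embed S i) (embed S j)
  ; sym    = λ i j → Graph.sym G (embed S i) (embed S j)
  ; irrefl = λ i → irrefl G (embed S i)
  }

degree≤sum : (G : Graph n) (v : Fin n) → degree G v ≤ sum (λ u → χᵇ (adj G v u))
degree≤sum {n} G v = count≤ {n} id
  where
  -- `allFin` is `tabulate id`; the induction needs a general `f`, since the tail of a `tabulate`
  -- composes it with `suc`.
  count≤ : ∀ {m} (f : Fin m → Fin n) →
    length (filterᵇ (adj G v) (tabulate f)) ≤ sum (λ i → χᵇ (adj G v (f i)))
  count≤ {zero}  f = z≤n
  count≤ {suc m} f with adj G v (f zero)
  ... | true  = s≤s (count≤ (f ∘ suc))
  ... | false = count≤ (f ∘ suc)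

-- The weight bound by induction on the size of the set.

module Decomposition (k : ℕ) (1≤k : 1 ≤ k) (G : Graph n) where

  e : Fin n → Fin n → ℕ
  e u v = χᵇ (adj G u v)

  open Weights k e (λ u v → χᵇ≤1 (adj G u v)) (λ u v → cong χᵇ (Graph.sym G u v)) (λ v → cong χᵇ (irrefl G v))

  HighlyConnectedSubgraph : Set
  HighlyConnectedSubgraph = Σ ℕ λ m → Σ (Graph m) λ H →
    IsSubgraph H G × (2 * k < m) × ((k + 1) -Connected) H

  -- If all three factors were 1, pulling `u` and `v` back to the induced subgraph would give a
  -- crossing edge.
  apart : (S : Subset n) (X A : Subset ∣ S ∣) → ¬ Crossing (induced G S) X A →
    ∀ u v → χ (image S (A ∩ ∁ X)) u * (χ (image S (∁ A ∩ ∁ X)) v * e u v) ≡ 0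
  apart S X A ¬crossing u v
    with lookup (image S (A ∩ ∁ X)) u in u-eq | lookup (image S (∁ A ∩ ∁ X)) v in v-eq | adj G u v in uv
  ... | false | _     | _     = refl
  ... | true  | false | _     = refl
  ... | true  | true  | false = refl
  ... | true  | true  | true
    with i , refl , i∈ ← image⁻ S (A ∩ ∁ X) (lookup⇒[]= u _ u-eq)
       | j , refl , j∈ ← image⁻ S (∁ A ∩ ∁ X) (lookup⇒[]= v _ v-eq)
    with i∈A , i∉X ← x∈p∩q⁻ A (∁ X) i∈ | j∉A , j∉X ← x∈p∩q⁻ (∁ A) (∁ X) j∈
    = contradiction
        (i , j , (i∈A , x∈∁p⇒x∉p i∉X) , (x∈∁p⇒x∉p j∉A , x∈∁p⇒x∉p j∉X) , subst T (≡-sym uv) _)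
        ¬crossing

  nonempty : ∀ {m} {p : Subset m} {i} → i ∈ p → 1 ≤ ∣ p ∣
  nonempty i∈p = ≤-trans (s≤s z≤n) (x∈p⇒∣p-x∣<∣p∣ i∈p)

  -- `N` is the induction parameter: each of `C` and `D` omits a nonempty side, hence is strictly
  -- smaller than `S`.
  bound : ∀ N (S : Subset n) → ∣ S ∣ ≤ N → 2 * k ≤ ∣ S ∣ →
    HighlyConnectedSubgraph ⊎ 2 * k * k ≤ W (χ S) (χ S)
  bound N S ∣S∣≤N 2k≤∣S∣ with ∣ S ∣ ≤? 2 * k
  -- A vertex has at most 2k - 1 neighbours in such a set, so all 2k weights equal `k`.
  ... | yes ∣S∣≤2k = inj₂ (≤-trans (*-monoˡ-≤ k (subst (2 * k ≤_) (≡-sym (sum-χ S)) 2k≤∣S∣))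
          (≤W (χ S) (χ S) λ v 1≤χ → k≤φ (≤-trans (deg<sum (χ S) v 1≤χ) (subst (_≤ 2 * k) (≡-sym (sum-χ S)) ∣S∣≤2k))))
  ... | no ∣S∣≰2k with connected-or-cut (induced G S) k
  ...   | inj₁ connected = inj₁ (∣ S ∣ , induced G S , (embed S , embed-injective S , λ _ _ → id) , ≰⇒> ∣S∣≰2k ,
            k+1<∣S∣ , λ X X<k+1 → connected X (s≤s⁻¹ (subst (suc ∣ X ∣ ≤_) (+-comm k 1) X<k+1)))
    where
    k+1<∣S∣ : k + 1 < ∣ S ∣
    -- This is k + 1 ≤ 2k < |S|, the first inequality coming from `1≤k`.
    k+1<∣S∣ = ≤-trans (s≤s (+-monoʳ-≤ k (≤-trans 1≤k (m≤m+n k 0)))) (≰⇒> ∣S∣≰2k)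
  bound zero    S ∣S∣≤N 2k≤∣S∣ | no ∣S∣≰2k | inj₂ _ = contradiction (≤-trans ∣S∣≤N z≤n) ∣S∣≰2k
  bound (suc N) S ∣S∣≤N 2k≤∣S∣ | no ∣S∣≰2k
    | inj₂ (X , A , ∣X∣≤k , (i , i∈A , i∉X) , (j , j∉A , j∉X) , ¬crossing) = result
    where
    a x b : Subset n
    a = image S (A ∩ ∁ X)
    x = image S X
    b = image S (∁ A ∩ ∁ X)
    C D : Subset n
    C = a ∪ x
    D = b ∪ x
    module B = TwoSides (χ a) (χ x) (χ b)
      (subst (_≤ k) (≡-sym (trans (sum-χ x) (∣image∣ S X))) ∣X∣≤k) (apart S X A ¬crossing)
    -- The mirrored instance serves the case in which `D` is the only small side.
    module B′ = TwoSides (χ b) (χ x) (χ a)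
      (subst (_≤ k) (≡-sym (trans (sum-χ x) (∣image∣ S X))) ∣X∣≤k) B.apart′
    split : χ S ≗ χ a ⊕ χ x ⊕ χ b
    split = image-partition S (A ∩ ∁ X) X (∁ A ∩ ∁ X) (χ-partition A X)
    disjoint : ∀ v → χ a v + χ x v + χ b v ≤ 1
    disjoint v = subst (_≤ 1) (split v) (χᵇ≤1 (lookup S v))
    χC : χ C ≗ χ a ⊕ χ x
    χC v = χ-∪ a x v (≤-trans (m≤m+n _ _) (disjoint v))
    χD : χ D ≗ χ b ⊕ χ x
    χD v = χ-∪ b x v (≤-trans (m≤m+n _ _) (≤-trans (≤-reflexive (+-reverse (χ b v) (χ x v) (χ a v))) (disjoint v)))
    ∣C∣ : ∣ C ∣ ≡ sum (χ a ⊕ χ x)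
    ∣C∣ = trans (≡-sym (sum-χ C)) (sum-cong-≗ χC)
    ∣D∣ : ∣ D ∣ ≡ sum (χ b ⊕ χ x)
    ∣D∣ = trans (≡-sym (sum-χ D)) (sum-cong-≗ χD)
    ∣S∣ : ∣ S ∣ ≡ sum (χ a ⊕ χ x ⊕ χ b)
    ∣S∣ = trans (≡-sym (sum-χ S)) (sum-cong-≗ split)
    1≤a : 1 ≤ sum (χ a)
    1≤a = subst (1 ≤_) (≡-sym (trans (sum-χ a) (∣image∣ S (A ∩ ∁ X))))
      (nonempty (x∈p∩q⁺ (i∈A , x∉p⇒x∈∁p i∉X)))
    1≤b : 1 ≤ sum (χ b)
    1≤b = subst (1 ≤_) (≡-sym (trans (sum-χ b) (∣image∣ S (∁ A ∩ ∁ X))))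
      (nonempty (x∈p∩q⁺ (x∉p⇒x∈∁p j∉A , x∉p⇒x∈∁p j∉X)))
    C<S : ∣ C ∣ < ∣ S ∣
    C<S = subst₂ _<_ (≡-sym ∣C∣) (≡-sym (trans ∣S∣ (sum-⊕ (χ a ⊕ χ x) (χ b))))
      (≤-trans (≤-reflexive (+-comm 1 _)) (+-monoʳ-≤ _ 1≤b))
    D<S : ∣ D ∣ < ∣ S ∣
    D<S = subst₂ _<_ (≡-sym ∣D∣) (≡-sym (trans ∣S∣ (trans (≡-sym (sum-cong-≗ B.swap)) (sum-⊕ (χ b ⊕ χ x) (χ a)))))
      (≤-trans (≤-reflexive (+-comm 1 _)) (+-monoʳ-≤ _ 1≤a))
    conclude : 2 * k * k ≤ W B.L.S B.L.S → HighlyConnectedSubgraph ⊎ 2 * k * k ≤ W (χ S) (χ S)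
    conclude = inj₂ ∘ subst (2 * k * k ≤_) (≡-sym (W-cong split))
    result : HighlyConnectedSubgraph ⊎ 2 * k * k ≤ W (χ S) (χ S)
    result with ≤-total (∣ C ∣) (2 * k) | ≤-total (∣ D ∣) (2 * k)
    ... | inj₁ C≤ | inj₁ D≤ = conclude (B.both-small (subst (_≤ 2 * k) ∣C∣ C≤) (subst (_≤ 2 * k) ∣D∣ D≤) (subst (2 * k ≤_) ∣S∣ 2k≤∣S∣))
    ... | inj₁ C≤ | inj₂ ≤D with bound N D (s≤s⁻¹ (≤-trans D<S ∣S∣≤N)) ≤D
    ...   | inj₁ H = inj₁ H
    ...   | inj₂ D-bound = conclude (B.C-small (subst (_≤ 2 * k) ∣C∣ C≤) (subst (2 * k * k ≤_) (W-cong χD) D-bound))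
    -- The induction bound for `C` serves both cases for `D`.
    result | inj₂ ≤C | D-cases with bound N C (s≤s⁻¹ (≤-trans C<S ∣S∣≤N)) ≤C | D-cases
    ...   | inj₁ H | _ = inj₁ H
    ...   | inj₂ C-bound | inj₁ D≤ = conclude (subst (2 * k * k ≤_) (W-cong B.swap)
              (B′.C-small (subst (_≤ 2 * k) ∣D∣ D≤) (subst (2 * k * k ≤_) (W-cong χC) C-bound)))
    ...   | inj₂ C-bound | inj₂ ≤D with bound N D (s≤s⁻¹ (≤-trans D<S ∣S∣≤N)) ≤D
    ...     | inj₁ H = inj₁ H
    ...     | inj₂ D-bound = conclude (B.both-big (subst (2 * k * k ≤_) (W-cong χC) C-bound) (subst (2 * k * k ≤_) (W-cong χD) D-bound))

  -- Conclusion for the whole vertex set.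

  module _ (1≤n : 1 ≤ n) (min-degree : MinDegree≥ G (3 * k ∸ 1)) where

    V : Subset n
    V = ⊤

    χV≡1 : ∀ v → χ V v ≡ 1
    χV≡1 v = cong χᵇ (lookup-replicate v true)

    -- This is what makes every weight in `V` vanish.
    3k≤1+deg : ∀ v → 3 * k ≤ suc (deg (χ V) v)
    3k≤1+deg v = begin
      3 * k                                ≤⟨ m≤n+m∸n (3 * k) 1 ⟩
      suc (3 * k ∸ 1)                      ≤⟨ s≤s (min-degree v) ⟩
      suc (degree G v)                     ≤⟨ s≤s (degree≤sum G v) ⟩
      suc (sum (e v))                      ≡⟨ cong suc (sum-cong-≗ λ u → trans (cong (_* e v u) (χV≡1 u)) (*-identityˡ (e v u))) ⟨
      suc (deg (χ V) v)                    ∎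
      where open ≤-Reasoning

    -- One vertex, which exists by `1≤n`, and its at least 3k - 1 neighbours already make 3k
    -- vertices.
    2k≤∣V∣ : 2 * k ≤ ∣ V ∣
    2k≤∣V∣ = begin
      2 * k                 ≤⟨ *-monoˡ-≤ k (n≤1+n 2) ⟩
      3 * k                 ≤⟨ 3k≤1+deg v ⟩
      suc (deg (χ V) v)     ≤⟨ deg<sum (χ V) v (≤-reflexive (≡-sym (χV≡1 v))) ⟩
      sum (χ V)             ≡⟨ sum-χ V ⟩
      ∣ V ∣             ∎
      where
      open ≤-Reasoning
      v : Fin n
      v = fromℕ< 1≤n

    W-V : W (χ V) (χ V) ≤ 0
    W-V = ≤-trans (W≤ (χ V) (χ V) λ v → ≤-trans (m⊓n≤n k _) (≤-reflexive (m≤n⇒m∸n≡0 (3k≤1+deg v))))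
      (≤-reflexive (*-zeroʳ (sum (χ V))))

    highlyConnectedSubgraph : HighlyConnectedSubgraph
    highlyConnectedSubgraph with bound n V (≤-reflexive (∣⊤∣≡n n)) 2k≤∣V∣
    ... | inj₁ H = H
    ... | inj₂ W-bound = contradiction
      -- Since k is positive, `2 * k * k` is at least 1, while the weight of `V` is 0.
      (≤-trans (*-mono-≤ (≤-trans 1≤k (m≤m+n k (k + 0))) 1≤k) (≤-trans W-bound W-V)) λ ()

theorem1 : (k : ℕ) → 1 ≤ k → (n : ℕ) → (G : Graph n) → 1 ≤ n →
    MinDegree≥ G (3 * k ∸ 1) →
    Σ ℕ λ m → Σ (Graph m) λ H →
    IsSubgraph H G × (2 * k < m) × ((k + 1) -Connected) H
theorem1 k 1≤k n G 1≤n = Decomposition.highlyConnectedSubgraph k 1≤k G 1≤n
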